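{- Let $H$ be the simple undirected graph with the $7$ vertices $A,B,C,D,E,F,G$ and the $10$ edges $$\{A,B\},\ \{A,C\},\ \{A,E\},\ \{A,G\},\ \{B,C\},\ \{C,D\},\ \{D,E\},\ \{D,G\},\ \{E,F\},\ \{F,G\}.$$ Then $H$ satisfies $\mathrm{CD}(0,\infty)$, but $H$ does not satisfy $\mathrm{CD}(0,n)$ for any $n\in(0,\infty)$.
   Context: For a locally finite graph with vertex set $V$ and edge set $\mathcal{E}$, write $N_x=\{y\in V:\{x,y\}\in \mathcal{E}\}$. The Laplacian acts on $f\in\mathbb{R}^V$ by $\Delta f(x)=\sum_{y\in N_x}(f(y)-f(x))$. For $f,g\in\mathbb{R}^V$, set $\Gamma_0(f,g)=fg$ and, for $k\ge 1$, $$\Gamma_k(f,g)=\tfrac12\left(\Delta\Gamma_{k-1}(f,g)-\Gamma_{k-1}(f,\Delta g)-\Gamma_{k-1}(g,\Delta f)\right).$$ For $\kappa\in\mathbb{R}$ and $n\in(0,\infty]$, the graph satisfies $\mathrm{CD}(\kappa,n)$ if for all $f\in\mathbb{R}^V$ and all $x\in V$, $$\Gamma_2(f,f)(x)\ge \kappa\,\Gamma_1(f,f)(x)+\frac{(\Delta f(x))^2}{n},$$ with the convention that the last term is $0$ when $n=\infty$. -}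

module Defs where

open import Data.Fin using (Fin)
open import Data.Fin.Patterns using (0F; 1F; 2F; 3F; 4F; 5F; 6F)
import Data.Fin.Properties as Fin
open import Data.List using (List; []; _∷_; allFin; filter; foldr; map)
open import Data.List.Membership.Propositional using (_∈_)
open import Data.List.Membership.Propositional.Properties using (∈-allFin; ∈-filter⁺; ∈-filter⁻)
import Data.List.Membership.DecPropositional as DecMembership
import Data.List.Relation.Unary.All as All
open import Data.List.Relation.Unary.Unique.Propositional using (Unique)
open import Data.List.Relation.Unary.Unique.Propositional.Properties using (allFin⁺; filter⁺)
open import Data.Nat as ℕ using (ℕ; zero; suc)
import Data.Nat.Properties as ℕ
open import Data.Product using (∃-syntax; _×_; _,_; proj₁; proj₂)
open import Data.Product.Properties using (≡-dec)
open import Data.Rational as ℚ using (ℚ; 0ℚ; 1ℚ; ½; ∣_∣; _⊔_; 1/_; Positive)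
import Data.Rational.Properties as ℚ
open import Data.Rational.Solver using (module +-*-Solver)
open import Data.Sum as Sum using (_⊎_)
open import Function using (_⇔_; mk⇔)
open import Level using (0ℓ)
open import Relation.Binary using (Rel; Decidable; Irreflexive; Symmetric)
open import Relation.Binary.PropositionalEquality
open import Relation.Nullary.Decidable using (_⊎-dec_; ¬?; from-yes)

IsCauchy : (ℕ → ℚ) → Set
IsCauchy s = ∀ ε → 0ℚ ℚ.< ε →
  ∃[ N ] (∀ m n → N ℕ.≤ m → N ℕ.≤ n → ∣ s m ℚ.- s n ∣ ℚ.≤ ε)

record ℝ : Set where
  constructor mkℝ
  field
    seq    : ℕ → ℚ
    cauchy : IsCauchy seq

open ℝ public

scaled : ∀ {ε δ} → 0ℚ ℚ.< ε → 0ℚ ℚ.< δ → 0ℚ ℚ.< ε ℚ.* δ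
scaled {ε} {δ} 0<ε 0<δ = ℚ.positive⁻¹ (ε ℚ.* δ)
  {{ℚ.pos*pos⇒pos ε {{ℚ.positive 0<ε}} δ {{ℚ.positive 0<δ}}}}

0<½ : 0ℚ ℚ.< ½
0<½ = ℚ.positive⁻¹ ½

halves : ∀ ε → ε ℚ.* ½ ℚ.+ ε ℚ.* ½ ≡ ε
halves ε = trans (sym (ℚ.*-distribˡ-+ ε ½ ½)) (ℚ.*-identityʳ ε)

*-mono-≤ : ∀ {p q r s} → 0ℚ ℚ.≤ r → 0ℚ ℚ.≤ q → p ℚ.≤ q → r ℚ.≤ s → p ℚ.* r ℚ.≤ q ℚ.* s
*-mono-≤ {p} {q} {r} {s} 0≤r 0≤q p≤q r≤s = ℚ.≤-trans
  (ℚ.*-monoʳ-≤-nonNeg r {{ℚ.nonNegative 0≤r}} p≤q)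
  (ℚ.*-monoˡ-≤-nonNeg q {{ℚ.nonNegative 0≤q}} r≤s)

eventuallyBounded : ∀ (x : ℝ) →
  ∃[ b ] ∃[ N ] (0ℚ ℚ.< b × (∀ n → N ℕ.≤ n → ∣ seq x n ∣ ℚ.≤ b))
eventuallyBounded (mkℝ s c) with c 1ℚ (ℚ.positive⁻¹ 1ℚ)
... | N , close = 1ℚ ℚ.+ ∣ s N ∣ , N , 0<b , bound
  where
  0<b : 0ℚ ℚ.< 1ℚ ℚ.+ ∣ s N ∣
  0<b = ℚ.+-mono-<-≤ (ℚ.positive⁻¹ 1ℚ) (ℚ.0≤∣p∣ (s N))

  bound : ∀ n → N ℕ.≤ n → ∣ s n ∣ ℚ.≤ 1ℚ ℚ.+ ∣ s N ∣
  bound n N≤n = begin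
    ∣ s n ∣                            ≡⟨ cong ∣_∣ (solve 2 (λ a b → a := (a :- b) :+ b) refl (s n) (s N)) ⟩
    ∣ (s n ℚ.- s N) ℚ.+ s N ∣          ≤⟨ ℚ.∣p+q∣≤∣p∣+∣q∣ (s n ℚ.- s N) (s N) ⟩
    ∣ s n ℚ.- s N ∣ ℚ.+ ∣ s N ∣        ≤⟨ ℚ.+-monoˡ-≤ ∣ s N ∣ (close n N N≤n ℕ.≤-refl) ⟩
    1ℚ ℚ.+ ∣ s N ∣                     ∎
    where
    open ℚ.≤-Reasoning
    open +-*-Solver

+-cauchy : ∀ (x y : ℝ) → IsCauchy (λ n → seq x n ℚ.+ seq y n)
+-cauchy x y ε 0<ε
  with cauchy x (ε ℚ.* ½) (scaled 0<ε 0<½) | cauchy y (ε ℚ.* ½) (scaled 0<ε 0<½)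
... | M , closeˣ | N , closeʸ = M ℕ.⊔ N , close
  where
  close : ∀ m n → M ℕ.⊔ N ℕ.≤ m → M ℕ.⊔ N ℕ.≤ n →
          ∣ (seq x m ℚ.+ seq y m) ℚ.- (seq x n ℚ.+ seq y n) ∣ ℚ.≤ ε
  close m n ≤m ≤n = begin
    ∣ (a ℚ.+ b) ℚ.- (c ℚ.+ d) ∣        ≡⟨ cong ∣_∣ (solve 4 (λ a b c d → (a :+ b) :- (c :+ d) := (a :- c) :+ (b :- d)) refl a b c d) ⟩
    ∣ (a ℚ.- c) ℚ.+ (b ℚ.- d) ∣        ≤⟨ ℚ.∣p+q∣≤∣p∣+∣q∣ (a ℚ.- c) (b ℚ.- d) ⟩
    ∣ a ℚ.- c ∣ ℚ.+ ∣ b ℚ.- d ∣        ≤⟨ ℚ.+-mono-≤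
                                            (closeˣ m n (ℕ.m⊔n≤o⇒m≤o M N ≤m) (ℕ.m⊔n≤o⇒m≤o M N ≤n))
                                            (closeʸ m n (ℕ.m⊔n≤o⇒n≤o M N ≤m) (ℕ.m⊔n≤o⇒n≤o M N ≤n)) ⟩
    ε ℚ.* ½ ℚ.+ ε ℚ.* ½                ≡⟨ halves ε ⟩
    ε                                  ∎
    where
    open ℚ.≤-Reasoning
    open +-*-Solver
    a = seq x m; b = seq y m; c = seq x n; d = seq y n

neg-cauchy : ∀ (x : ℝ) → IsCauchy (λ n → ℚ.- seq x n)
neg-cauchy x ε 0<ε with cauchy x ε 0<ε
... | N , close = N , λ m n ≤m ≤n →
  subst (ℚ._≤ ε) (trans (sym (ℚ.∣-p∣≡∣p∣ (seq x m ℚ.- seq x n)))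
                        (cong ∣_∣ (ℚ.neg-distrib-+ (seq x m) (ℚ.- seq x n))))
        (close m n ≤m ≤n)

*-close : ∀ {a b c d α β p q} → 0ℚ ℚ.≤ α → 0ℚ ℚ.≤ β →
  ∣ a ℚ.- c ∣ ℚ.≤ α → ∣ b ∣ ℚ.≤ q → ∣ b ℚ.- d ∣ ℚ.≤ β → ∣ c ∣ ℚ.≤ p →
  ∣ a ℚ.* b ℚ.- c ℚ.* d ∣ ℚ.≤ α ℚ.* q ℚ.+ β ℚ.* p
*-close {a} {b} {c} {d} {α} {β} {p} {q} 0≤α 0≤β a-c b≤q b-d c≤p = begin
  ∣ a ℚ.* b ℚ.- c ℚ.* d ∣                          ≡⟨ cong ∣_∣ (split a b c d) ⟩
  ∣ (a ℚ.- c) ℚ.* b ℚ.+ (b ℚ.- d) ℚ.* c ∣          ≤⟨ ℚ.∣p+q∣≤∣p∣+∣q∣ ((a ℚ.- c) ℚ.* b) ((b ℚ.- d) ℚ.* c) ⟩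
  ∣ (a ℚ.- c) ℚ.* b ∣ ℚ.+ ∣ (b ℚ.- d) ℚ.* c ∣      ≡⟨ cong₂ ℚ._+_ (ℚ.∣p*q∣≡∣p∣*∣q∣ (a ℚ.- c) b) (ℚ.∣p*q∣≡∣p∣*∣q∣ (b ℚ.- d) c) ⟩
  ∣ a ℚ.- c ∣ ℚ.* ∣ b ∣ ℚ.+ ∣ b ℚ.- d ∣ ℚ.* ∣ c ∣  ≤⟨ ℚ.+-mono-≤ (*-mono-≤ (ℚ.0≤∣p∣ b) 0≤α a-c b≤q)
                                                                   (*-mono-≤ (ℚ.0≤∣p∣ c) 0≤β b-d c≤p) ⟩
  α ℚ.* q ℚ.+ β ℚ.* p                              ∎
  where
  open ℚ.≤-Reasoning
  open +-*-Solver
  split : ∀ a b c d → a ℚ.* b ℚ.- c ℚ.* d ≡ (a ℚ.- c) ℚ.* b ℚ.+ (b ℚ.- d) ℚ.* c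
  split = solve 4 (λ a b c d → a :* b :- c :* d := (a :- c) :* b :+ (b :- d) :* c) refl

quotient : ∀ {δ r} → 0ℚ ℚ.< δ → 0ℚ ℚ.< r → ∃[ η ] (0ℚ ℚ.< η × η ℚ.* r ≡ δ)
quotient {δ} {r} 0<δ 0<r = δ ℚ.* 1/ r , scaled 0<δ (ℚ.positive⁻¹ (1/ r) {{ℚ.1/pos⇒pos r}}) ,
  trans (ℚ.*-assoc δ (1/ r) r) (trans (cong (δ ℚ.*_) (ℚ.*-inverseˡ r)) (ℚ.*-identityʳ δ))
  where
  instance
    r-positive : Positive r
    r-positive = ℚ.positive 0<r
    r-nonZero : ℚ.NonZero r
    r-nonZero = ℚ.pos⇒nonZero r

*-cauchy : ∀ (x y : ℝ) → IsCauchy (λ n → seq x n ℚ.* seq y n)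
*-cauchy x y ε 0<ε =
  let p , K , 0<p , ∣x∣≤p = eventuallyBounded x
      q , L , 0<q , ∣y∣≤q = eventuallyBounded y
      α , 0<α , αq≡ε/2 = quotient (scaled 0<ε 0<½) 0<q
      β , 0<β , βp≡ε/2 = quotient (scaled 0<ε 0<½) 0<p
      M , closeˣ = cauchy x α 0<α
      N , closeʸ = cauchy y β 0<β
      KL≤ : ∀ {k} → (K ℕ.⊔ L) ℕ.⊔ (M ℕ.⊔ N) ℕ.≤ k → K ℕ.⊔ L ℕ.≤ k
      KL≤ = ℕ.m⊔n≤o⇒m≤o (K ℕ.⊔ L) (M ℕ.⊔ N)
      MN≤ : ∀ {k} → (K ℕ.⊔ L) ℕ.⊔ (M ℕ.⊔ N) ℕ.≤ k → M ℕ.⊔ N ℕ.≤ k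
      MN≤ = ℕ.m⊔n≤o⇒n≤o (K ℕ.⊔ L) (M ℕ.⊔ N)
  in (K ℕ.⊔ L) ℕ.⊔ (M ℕ.⊔ N) , λ m n ≤m ≤n →
     ℚ.≤-trans
       (*-close {seq x m} {seq y m} {seq x n} {seq y n} (ℚ.<⇒≤ 0<α) (ℚ.<⇒≤ 0<β)
         (closeˣ m n (ℕ.m⊔n≤o⇒m≤o M N (MN≤ ≤m)) (ℕ.m⊔n≤o⇒m≤o M N (MN≤ ≤n))) (∣y∣≤q m (ℕ.m⊔n≤o⇒n≤o K L (KL≤ ≤m)))
         (closeʸ m n (ℕ.m⊔n≤o⇒n≤o M N (MN≤ ≤m)) (ℕ.m⊔n≤o⇒n≤o M N (MN≤ ≤n))) (∣x∣≤p n (ℕ.m⊔n≤o⇒m≤o K L (KL≤ ≤n))))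
       (ℚ.≤-reflexive (trans (cong₂ ℚ._+_ αq≡ε/2 βp≡ε/2) (halves ε)))

fromℚ : ℚ → ℝ
fromℚ q = mkℝ (λ _ → q) λ ε 0<ε →
  0 , λ _ _ _ _ → ℚ.≤-trans (ℚ.≤-reflexive (cong ∣_∣ (ℚ.+-inverseʳ q))) (ℚ.<⇒≤ 0<ε)

0ℝ ½ℝ : ℝ
0ℝ = fromℚ 0ℚ
½ℝ = fromℚ ½

infixl 6 _+_ _-_
infixl 7 _*_
infix  4 _≤_ _≥_ _<_

_+_ _-_ _*_ : ℝ → ℝ → ℝ
x + y = mkℝ (λ n → seq x n ℚ.+ seq y n) (+-cauchy x y)
x - y = x + mkℝ (λ n → ℚ.- seq y n) (neg-cauchy y)
x * y = mkℝ (λ n → seq x n ℚ.* seq y n) (*-cauchy x y)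

-- Two sequences represent the same real iff each is ≤ the other.

_≤_ _≥_ _<_ : ℝ → ℝ → Set
x ≤ y = ∀ ε → 0ℚ ℚ.< ε → ∃[ N ] (∀ n → N ℕ.≤ n → seq x n ℚ.≤ seq y n ℚ.+ ε)
x ≥ y = y ≤ x
x < y = ∃[ ε ] (0ℚ ℚ.< ε × ∃[ N ] (∀ n → N ℕ.≤ n → seq x n ℚ.+ ε ℚ.≤ seq y n))

⊔-positive : ∀ p e → 0ℚ ℚ.< e → Positive (p ⊔ e)
⊔-positive p e 0<e = ℚ.positive (ℚ.<-≤-trans 0<e (ℚ.p≤q⊔p p e))

recip : (p e : ℚ) → 0ℚ ℚ.< e → ℚ
recip p e 0<e = (1/ (p ⊔ e)) {{ℚ.pos⇒nonZero (p ⊔ e) {{⊔-positive p e 0<e}}}}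

inverse-close : ∀ {a b u v e ε} → 0ℚ ℚ.< e → 0ℚ ℚ.≤ ε → 0ℚ ℚ.≤ u → 0ℚ ℚ.≤ v →
  e ℚ.≤ a → e ℚ.≤ b → a ℚ.* u ≡ 1ℚ → b ℚ.* v ≡ 1ℚ →
  ∣ b ℚ.- a ∣ ℚ.≤ ε ℚ.* (e ℚ.* e) → ∣ u ℚ.- v ∣ ℚ.≤ ε
inverse-close {a} {b} {u} {v} {e} {ε} 0<e 0≤ε 0≤u 0≤v e≤a e≤b au bv b-a = begin
  ∣ u ℚ.- v ∣                               ≡⟨ cong ∣_∣ (cong₂ ℚ._-_ (sym (ℚ.*-identityʳ u)) (sym (ℚ.*-identityʳ v))) ⟩
  ∣ u ℚ.* 1ℚ ℚ.- v ℚ.* 1ℚ ∣                 ≡⟨ cong ∣_∣ (cong₂ (λ s t → u ℚ.* s ℚ.- v ℚ.* t) (sym bv) (sym au)) ⟩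
  ∣ u ℚ.* (b ℚ.* v) ℚ.- v ℚ.* (a ℚ.* u) ∣   ≡⟨ cong ∣_∣ (factor u v a b) ⟩
  ∣ (b ℚ.- a) ℚ.* (u ℚ.* v) ∣               ≡⟨ ℚ.∣p*q∣≡∣p∣*∣q∣ (b ℚ.- a) (u ℚ.* v) ⟩
  ∣ b ℚ.- a ∣ ℚ.* ∣ u ℚ.* v ∣               ≡⟨ cong (∣ b ℚ.- a ∣ ℚ.*_) (ℚ.0≤p⇒∣p∣≡p 0≤uv) ⟩
  ∣ b ℚ.- a ∣ ℚ.* (u ℚ.* v)                 ≤⟨ ℚ.*-monoʳ-≤-nonNeg (u ℚ.* v) {{ℚ.nonNegative 0≤uv}} b-a ⟩
  ε ℚ.* (e ℚ.* e) ℚ.* (u ℚ.* v)             ≡⟨ regroup ε e u v ⟩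
  ε ℚ.* ((e ℚ.* u) ℚ.* (e ℚ.* v))           ≤⟨ ℚ.*-monoˡ-≤-nonNeg ε {{ℚ.nonNegative 0≤ε}}
                                                 (*-mono-≤ (0≤* (ℚ.<⇒≤ 0<e) 0≤v) (ℚ.nonNegative⁻¹ 1ℚ)
                                                   (≤1 0≤u e≤a au) (≤1 0≤v e≤b bv)) ⟩
  ε ℚ.* 1ℚ                                  ≡⟨ ℚ.*-identityʳ ε ⟩
  ε                                         ∎
  where
  open ℚ.≤-Reasoning
  open +-*-Solver
  factor : ∀ u v a b → u ℚ.* (b ℚ.* v) ℚ.- v ℚ.* (a ℚ.* u) ≡ (b ℚ.- a) ℚ.* (u ℚ.* v)
  factor = solve 4 (λ u v a b → u :* (b :* v) :- v :* (a :* u) := (b :- a) :* (u :* v)) refl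
  regroup : ∀ ε e u v → ε ℚ.* (e ℚ.* e) ℚ.* (u ℚ.* v) ≡ ε ℚ.* ((e ℚ.* u) ℚ.* (e ℚ.* v))
  regroup = solve 4 (λ ε e u v → ε :* (e :* e) :* (u :* v) := ε :* ((e :* u) :* (e :* v))) refl
  0≤* : ∀ {p q} → 0ℚ ℚ.≤ p → 0ℚ ℚ.≤ q → 0ℚ ℚ.≤ p ℚ.* q
  0≤* {p} {q} 0≤p 0≤q = subst (ℚ._≤ p ℚ.* q) (ℚ.*-zeroʳ p)
    (ℚ.*-monoˡ-≤-nonNeg p {{ℚ.nonNegative 0≤p}} 0≤q)
  0≤uv : 0ℚ ℚ.≤ u ℚ.* v
  0≤uv = 0≤* 0≤u 0≤v
  ≤1 : ∀ {p w} → 0ℚ ℚ.≤ w → e ℚ.≤ p → p ℚ.* w ≡ 1ℚ → e ℚ.* w ℚ.≤ 1ℚ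
  ≤1 {p} {w} 0≤w e≤p pw = subst (e ℚ.* w ℚ.≤_) pw
    (ℚ.*-monoʳ-≤-nonNeg w {{ℚ.nonNegative 0≤w}} e≤p)

*-recip : ∀ {p e} (0<e : 0ℚ ℚ.< e) → e ℚ.≤ p → p ℚ.* recip p e 0<e ≡ 1ℚ
*-recip {p} {e} 0<e e≤p = subst (λ t → t ℚ.* recip p e 0<e ≡ 1ℚ) (ℚ.p≥q⇒p⊔q≡p e≤p)
  (ℚ.*-inverseʳ (p ⊔ e) {{ℚ.pos⇒nonZero (p ⊔ e) {{⊔-positive p e 0<e}}}})

0≤recip : ∀ p {e} (0<e : 0ℚ ℚ.< e) → 0ℚ ℚ.≤ recip p e 0<e
0≤recip p {e} 0<e = ℚ.<⇒≤ (ℚ.positive⁻¹ (recip p e 0<e)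
  {{ℚ.1/pos⇒pos (p ⊔ e) {{⊔-positive p e 0<e}}}})

recip-cauchy : ∀ (x : ℝ) (0<x : 0ℝ < x) →
               IsCauchy (λ n → recip (seq x n) (proj₁ 0<x) (proj₁ (proj₂ 0<x)))
recip-cauchy x (e , 0<e , K , e≤x) ε 0<ε =
  let N , close = cauchy x (ε ℚ.* (e ℚ.* e)) (scaled 0<ε (scaled 0<e 0<e))
      e≤ = λ n ≤n → subst (ℚ._≤ seq x n) (ℚ.+-identityˡ e) (e≤x n (ℕ.m⊔n≤o⇒m≤o K N ≤n))
  in K ℕ.⊔ N , λ m n ≤m ≤n →
     inverse-close {seq x m} {seq x n} 0<e (ℚ.<⇒≤ 0<ε)
       (0≤recip (seq x m) 0<e) (0≤recip (seq x n) 0<e) (e≤ m ≤m) (e≤ n ≤n)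
       (*-recip 0<e (e≤ m ≤m)) (*-recip 0<e (e≤ n ≤n))
       (close n m (ℕ.m⊔n≤o⇒n≤o K N ≤n) (ℕ.m⊔n≤o⇒n≤o K N ≤m))

-- The proof of positivity supplies a rational e > 0 with e ≤ xₙ for all
-- large n.  The sequence 1 / max(xₙ , e) is therefore eventually 1 / xₙ;
-- taking the maximum only repairs the finitely many terms below e.

inverse : (x : ℝ) → 0ℝ < x → ℝ
inverse x 0<x@(e , 0<e , _) = mkℝ (λ n → recip (seq x n) e 0<e) (recip-cauchy x 0<x)

record LocallyFiniteGraph : Set₁ where
  infix 4 _~_
  field
    Vertex            : Set
    _~_               : Rel Vertex 0ℓ
    ~-sym             : Symmetric _~_
    ~-irrefl          : Irreflexive _≡_ _~_
    neighbours        : Vertex → List Vertex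
    neighbours-unique : ∀ x → Unique (neighbours x)
    ∈-neighbours      : ∀ {x y} → y ∈ neighbours x ⇔ x ~ y

data Dimension : Set where
  finite : (n : ℝ) → 0ℝ < n → Dimension
  ∞      : Dimension

infixl 7 _/ᵈ_

_/ᵈ_ : ℝ → Dimension → ℝ
x /ᵈ finite n 0<n = x * inverse n 0<n
x /ᵈ ∞            = 0ℝ

module _ (𝓖 : LocallyFiniteGraph) where

  open LocallyFiniteGraph 𝓖

  Δ : (Vertex → ℝ) → (Vertex → ℝ)
  Δ f x = foldr _+_ 0ℝ (map (λ y → f y - f x) (neighbours x))

  Γ : ℕ → (f g : Vertex → ℝ) → (Vertex → ℝ)
  Γ zero    f g x = f x * g x
  Γ (suc k) f g x = ½ℝ * (Δ (Γ k f g) x - Γ k f (Δ g) x - Γ k g (Δ f) x)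

  CD : ℝ → Dimension → Set
  CD κ n = ∀ (f : Vertex → ℝ) (x : Vertex) →
    Γ 2 f f x ≥ κ * Γ 1 f f x + (Δ f x * Δ f x) /ᵈ n

pattern A = 0F
pattern B = 1F
pattern C = 2F
pattern D = 3F
pattern E = 4F
pattern F = 5F
pattern G = 6F

edges : List (Fin 7 × Fin 7)
edges = (A , B) ∷ (A , C) ∷ (A , E) ∷ (A , G) ∷ (B , C)
      ∷ (C , D) ∷ (D , E) ∷ (D , G) ∷ (E , F) ∷ (F , G) ∷ []

Adjacent : Rel (Fin 7) 0ℓ
Adjacent x y = (x , y) ∈ edges ⊎ (y , x) ∈ edges

adjacent? : Decidable Adjacent
adjacent? x y = ((x , y) ∈? edges) ⊎-dec ((y , x) ∈? edges)
  where
  open DecMembership (≡-dec Fin._≟_ Fin._≟_) using (_∈?_)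

H : LocallyFiniteGraph
H = record
  { Vertex            = Fin 7
  ; _~_               = Adjacent
  ; ~-sym             = Sum.swap
  ; ~-irrefl          = λ { refl → Sum.[ noLoop , noLoop ] }
  ; neighbours        = λ x → filter (adjacent? x) (allFin 7)
  ; neighbours-unique = λ x → filter⁺ (adjacent? x) (allFin⁺ 7)
  ; ∈-neighbours      = λ {x} {y} → mk⇔
      (λ y∈ → proj₂ (∈-filter⁻ (adjacent? x) {xs = allFin 7} y∈))
      (∈-filter⁺ (adjacent? x) (∈-allFin y))
  }
  where
  noLoop : ∀ {x} → (x , x) ∈ edges → _
  noLoop xx∈ = All.lookup (from-yes (All.all? (λ e → ¬? (proj₁ e Fin.≟ proj₂ e)) edges)) xx∈ refl

{-# OPTIONS --safe #-}
-- Every operation on ℝ acts termwise on Cauchy sequences, so the n-th term of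
-- Γ₂(f , f)(x) is a quadratic form in the n-th terms of the values of f.  At each
-- of the seven vertices this form is a sum of squares over ℚ, hence CD(0 , ∞).
-- At A it is degenerate beyond the constants: some f has Γ₂(f , f)(A) = 0 and
-- Δf(A) = 1, so CD(0 , n) would force 1/n ≤ 0.

module Submission where

open import Defs
open import Data.Fin using (Fin)
import Data.Fin.Properties as Fin
open import Data.Integer using (+_)
open import Data.List using (List; []; _∷_; foldr; map)
open import Data.List.Relation.Unary.All as All using (All; []; _∷_)
open import Data.Nat as ℕ using (ℕ; zero; suc)
import Data.Nat.Properties as ℕ
open import Data.Product using (_×_; _,_; proj₁)
open import Data.Rational as ℚ using (ℚ; 0ℚ; 1ℚ; ½; _⊔_; _/_)
import Data.Rational.Properties as ℚ
open import Data.Rational.Solver using (module +-*-Solver)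
open import Data.Vec using (Vec; tabulate)
open import Data.Sum using (inj₁; inj₂)
open import Relation.Binary.PropositionalEquality
open import Relation.Nullary using (¬_)
open import Relation.Nullary.Decidable using (from-yes; from-no)

open +-*-Solver using (Polynomial; var; con; ⟦_⟧; prove; _:+_; _:*_; _:-_)
open LocallyFiniteGraph H using (neighbours)

Poly : Set
Poly = Polynomial 7

-- Δ and Γ with formal values of the functions: evaluating Γᴾ k var var x gives
-- definitionally the terms of Γ H k f f x once x is a concrete vertex.
Δᴾ : (Fin 7 → Poly) → Fin 7 → Poly
Δᴾ p x = foldr _:+_ (con 0ℚ) (map (λ y → p y :- p x) (neighbours x))

Γᴾ : ℕ → (p q : Fin 7 → Poly) → Fin 7 → Poly
Γᴾ zero    p q x = p x :* q x
Γᴾ (suc k) p q x = con ½ :* (Δᴾ (Γᴾ k p q) x :- Γᴾ k p (Δᴾ q) x :- Γᴾ k q (Δᴾ p) x)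

infixr 8 _·_
_·_ : ℕ → Poly → Poly
k · p = con (+ k / 1) :* p

a b c d e f g : Poly
a = var A
b = var B
c = var C
d = var D
e = var E
f = var F
g = var G

-- Obtained by completing squares in Γ₂(f , f)(x), first in the values of f at
-- distance 2 from x and then in the values at the neighbours of x.
squares : Fin 7 → List (ℚ × Poly)
squares A = (+ 1 / 12 , 3 · a :+ 3 · d :- 2 · c :- 2 · e :- 2 · g)
          ∷ (+ 1 / 2 , a :+ f :- e :- g)
          ∷ (+ 1 / 20 , 5 · b :+ 2 · e :+ 2 · g :- 7 · a :- 2 · c)
          ∷ (+ 11 / 120 , 4 · c :+ e :+ g :- 6 · a)
          ∷ (+ 5 / 8 , e :- g) ∷ []
squares B = (+ 1 / 4 , b :+ d :- 2 · c)
          ∷ (+ 1 / 4 , b :+ e :- 2 · a)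
          ∷ (+ 1 / 4 , b :+ g :- 2 · a)
          ∷ (+ 1 / 20 , 5 · a :- 3 · b :- 2 · c)
          ∷ (+ 13 / 10 , c :- b) ∷ []
squares C = (+ 1 / 2 , c :+ e :- a :- d)
          ∷ (+ 1 / 2 , c :+ g :- a :- d)
          ∷ (+ 1 / 8 , 4 · a :- b :- 2 · c :- d)
          ∷ (+ 1 / 88 , 11 · b :+ 3 · d :- 14 · c)
          ∷ (+ 17 / 22 , d :- c) ∷ []
squares D = (+ 1 / 12 , 3 · a :+ 3 · d :- 2 · c :- 2 · e :- 2 · g)
          ∷ (+ 1 / 4 , b :+ d :- 2 · c)
          ∷ (+ 1 / 2 , d :+ f :- e :- g)
          ∷ (+ 1 / 24 , 4 · c :+ e :+ g :- 6 · d)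
          ∷ (+ 1 / 8 , 3 · e :- 2 · d :- g)
          ∷ (+ 1 / 1 , g :- d) ∷ []
squares E = (+ 1 / 4 , b :+ e :- 2 · a)
          ∷ (+ 1 / 2 , c :+ e :- a :- d)
          ∷ (+ 1 / 12 , 3 · e :+ 3 · g :- 2 · a :- 2 · d :- 2 · f)
          ∷ (+ 1 / 132 , 11 · a :+ 2 · f :- 4 · d :- 9 · e)
          ∷ (+ 1 / 506 , 23 · d :+ 5 · f :- 28 · e)
          ∷ (+ 77 / 92 , f :- e) ∷ []
squares F = (+ 1 / 2 , a :+ f :- e :- g)
          ∷ (+ 1 / 2 , d :+ f :- e :- g)
          ∷ (+ 1 / 20 , 5 · e :- 3 · f :- 2 · g)
          ∷ (+ 21 / 20 , g :- f) ∷ []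
squares G = (+ 1 / 4 , b :+ g :- 2 · a)
          ∷ (+ 1 / 2 , c :+ g :- a :- d)
          ∷ (+ 1 / 12 , 3 · e :+ 3 · g :- 2 · a :- 2 · d :- 2 · f)
          ∷ (+ 1 / 132 , 11 · a :+ 2 · f :- 4 · d :- 9 · g)
          ∷ (+ 1 / 506 , 23 · d :+ 5 · f :- 28 · g)
          ∷ (+ 77 / 92 , f :- g) ∷ []

sumOfSquares : List (ℚ × Poly) → Poly
sumOfSquares = foldr (λ { (w , l) s → con w :* (l :* l) :+ s }) (con 0ℚ)

0≤sumOfSquares : ∀ ρ {ws} → All (λ s → 0ℚ ℚ.≤ proj₁ s) ws → 0ℚ ℚ.≤ ⟦ sumOfSquares ws ⟧ ρ
0≤sumOfSquares ρ []                        = ℚ.≤-refl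
0≤sumOfSquares ρ {(w , l) ∷ _} (0≤w ∷ 0≤ws) =
  ℚ.+-mono-≤ (0≤* 0≤w (0≤square (⟦ l ⟧ ρ))) (0≤sumOfSquares ρ 0≤ws)
  where
  0≤* : ∀ {p q} → 0ℚ ℚ.≤ p → 0ℚ ℚ.≤ q → 0ℚ ℚ.≤ p ℚ.* q
  0≤* 0≤p 0≤q = *-mono-≤ {0ℚ} {r = 0ℚ} ℚ.≤-refl 0≤p 0≤p 0≤q

  0≤square : ∀ p → 0ℚ ℚ.≤ p ℚ.* p
  0≤square p with ℚ.≤-total 0ℚ p
  ... | inj₁ 0≤p = 0≤* 0≤p 0≤p
  -- Despite its name, `ℚ.nonPos*nonPos⇒nonPos` makes the product nonnegative.
  ... | inj₂ p≤0 = ℚ.nonNegative⁻¹ (p ℚ.* p) {{ℚ.nonPos*nonPos⇒nonPos p {{np}} p {{np}}}}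
    where np = ℚ.nonPositive p≤0

weights≥0 : ∀ x → All (λ s → 0ℚ ℚ.≤ proj₁ s) (squares x)
weights≥0 = from-yes (Fin.all? (λ x → All.all? (λ s → 0ℚ ℚ.≤? proj₁ s) (squares x)))

values : (Fin 7 → ℝ) → ℕ → Vec ℚ 7
values f n = tabulate (λ y → seq (f y) n)

-- An identity of quadratic forms in seven variables, checked by comparing normal forms. The
-- vertices are split because `neighbours x` computes only at a concrete `x`.
Γ₂-sumOfSquares : ∀ f x n →
  seq (Γ H 2 f f x) n ≡ ⟦ sumOfSquares (squares x) ⟧ (values f n)
Γ₂-sumOfSquares f A n = prove (values f n) (Γᴾ 2 var var A) (sumOfSquares (squares A)) refl
Γ₂-sumOfSquares f B n = prove (values f n) (Γᴾ 2 var var B) (sumOfSquares (squares B)) refl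
Γ₂-sumOfSquares f C n = prove (values f n) (Γᴾ 2 var var C) (sumOfSquares (squares C)) refl
Γ₂-sumOfSquares f D n = prove (values f n) (Γᴾ 2 var var D) (sumOfSquares (squares D)) refl
Γ₂-sumOfSquares f E n = prove (values f n) (Γᴾ 2 var var E) (sumOfSquares (squares E)) refl
Γ₂-sumOfSquares f F n = prove (values f n) (Γᴾ 2 var var F) (sumOfSquares (squares F)) refl
Γ₂-sumOfSquares f G n = prove (values f n) (Γᴾ 2 var var G) (sumOfSquares (squares G)) refl

CD[0,∞] : CD H 0ℝ ∞
-- The inequality holds for every term of the sequences, so the threshold `0` serves each `ε`.
CD[0,∞] f x ε 0<ε = 0 , λ n _ → begin
  0ℚ ℚ.* seq (Γ H 1 f f x) n ℚ.+ 0ℚ                   ≡⟨ ℚ.+-identityʳ (0ℚ ℚ.* seq (Γ H 1 f f x) n) ⟩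
  0ℚ ℚ.* seq (Γ H 1 f f x) n                          ≡⟨ ℚ.*-zeroˡ (seq (Γ H 1 f f x) n) ⟩
  0ℚ                                                  ≤⟨ 0≤sumOfSquares (values f n) (weights≥0 x) ⟩
  ⟦ sumOfSquares (squares x) ⟧ (values f n)           ≡⟨ Γ₂-sumOfSquares f x n ⟨
  seq (Γ H 2 f f x) n                                 ≡⟨ ℚ.+-identityʳ (seq (Γ H 2 f f x) n) ⟨
  seq (Γ H 2 f f x) n ℚ.+ 0ℚ                          ≤⟨ ℚ.+-monoʳ-≤ (seq (Γ H 2 f f x) n) (ℚ.<⇒≤ 0<ε) ⟩
  seq (Γ H 2 f f x) n ℚ.+ ε                           ∎
  where open ℚ.≤-Reasoning

-- A Cauchy sequence is eventually bounded by some `b`, so the terms of the inverse eventually stay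
-- above the positive constant 1 / (b ⊔ e).
inverse≰0 : ∀ x (0<x : 0ℝ < x) → ¬ inverse x 0<x ≤ 0ℝ
inverse≰0 x 0<x@(e , 0<e , _) inverse≤0 =
  let b , M , 0<b , ∣x∣≤b = eventuallyBounded x
      -- With this `ε`, half of 1 / (b ⊔ e), the bounds r ≤ ε and p ⊔ e ≤ b ⊔ e multiply to 1 ≤ ½.
      ε , 0<ε , ε[b⊔e]≡½  = quotient 0<½ (ℚ.positive⁻¹ (b ⊔ e) {{⊔-positive b e 0<e}})
      N , small           = inverse≤0 ε 0<ε
      k                   = M ℕ.⊔ N
      p                   = seq x k
      r                   = recip p e 0<e
      instance p⊔e≢0      = ℚ.pos⇒nonZero (p ⊔ e) {{⊔-positive p e 0<e}}
      r≤ε                 = subst (r ℚ.≤_) (ℚ.+-identityˡ ε) (small k (ℕ.m≤n⊔m M N))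
      p≤b                 = ℚ.≤-trans (p≤∣p∣ p) (∣x∣≤b k (ℕ.m≤m⊔n M N))
      0≤p⊔e               = ℚ.<⇒≤ (ℚ.positive⁻¹ (p ⊔ e) {{⊔-positive p e 0<e}})
  in from-no (1ℚ ℚ.≤? ½) (subst₂ ℚ._≤_ (ℚ.*-inverseˡ (p ⊔ e)) ε[b⊔e]≡½
       (*-mono-≤ 0≤p⊔e (ℚ.<⇒≤ 0<ε) r≤ε (ℚ.⊔-monoˡ-≤ e p≤b)))
  where
  p≤∣p∣ : ∀ p → p ℚ.≤ ℚ.∣ p ∣
  p≤∣p∣ p with ℚ.≤-total 0ℚ p
  ... | inj₁ 0≤p = ℚ.≤-reflexive (sym (ℚ.0≤p⇒∣p∣≡p 0≤p))
  ... | inj₂ p≤0 = ℚ.≤-trans p≤0 (ℚ.0≤∣p∣ p)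

-- Spans, modulo constants, the kernel of the quadratic form f ↦ Γ₂(f , f)(A).
witness : Fin 7 → ℝ
witness A = fromℚ 0ℚ
witness B = fromℚ (ℚ.- (+ 2 / 1))
witness C = fromℚ (ℚ.- 1ℚ)
witness D = fromℚ (+ 2 / 1)
witness E = fromℚ (+ 2 / 1)
witness F = fromℚ (+ 4 / 1)
witness G = fromℚ (+ 2 / 1)

¬CD[0,n] : (n : ℝ) (0<n : 0ℝ < n) → ¬ CD H 0ℝ (finite n 0<n)
¬CD[0,n] n 0<n cd = inverse≰0 n 0<n λ ε 0<ε →
  -- All five linear forms in `squares A` vanish at `witness`, whose scale is chosen so that Δf(A) =
  -- -2 - 1 + 2 + 2 = 1. By computation with closed rationals, `close` therefore bounds 0 + 1 ·
  -- (1/n) by 0 + ε, term by term.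
  let N , close = cd witness A ε 0<ε
  in N , λ k N≤k → subst (ℚ._≤ 0ℚ ℚ.+ ε)
       (trans (ℚ.+-identityˡ _) (ℚ.*-identityˡ (seq (inverse n 0<n) k))) (close k N≤k)

lemma3 : CD H 0ℝ ∞ × ((n : ℝ) (0<n : 0ℝ < n) → ¬ CD H 0ℝ (finite n 0<n))
lemma3 = CD[0,∞] , ¬CD[0,n]
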